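{- Let $k\ge 1$ be an integer, $z\ge 1$ a constant and $\varepsilon\in(0,1)$ a real number. For every positive integer $d\le\frac{1}{100\varepsilon^2}$, there is a finite dataset $P\subset\mathbb{R}^{d+1}$ such that every $\varepsilon$-coreset of $P$ for Euclidean $(k,z)$-Clustering contains at least $\frac{dk}{10z^4}$ points.
   Context: For a finite $P\subset\mathbb{R}^{D}$ and a set $C\subset\mathbb{R}^{D}$ of $k$ centers, $\mathrm{cost}_z(P,C)=\sum_{p\in P}\min_{c\in C}\|p-c\|_2^z$. An $\varepsilon$-coreset of $P$ for Euclidean $(k,z)$-Clustering is a subset $S\subseteq P$ with a weight function $w:S\to\mathbb{R}_{\ge 0}$ such that for every $C\subset\mathbb{R}^{D}$ with $|C|=k$, $$(1-\varepsilon)\,\mathrm{cost}_z(P,C)\le\sum_{p\in S}w(p)\min_{c\in C}\|p-c\|_2^z\le(1+\varepsilon)\,\mathrm{cost}_z(P,C).$$ Here $D=d+1$. -}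

module Defs where

open import Level using (0ℓ)
open import Algebra.Bundles using (CommutativeRing)
import Algebra.Construct.NaturalChoice.Min as Min
import Algebra.Properties.Monoid.Mult as Mult
import Algebra.Properties.Monoid.Sum as Sum
import Algebra.Properties.Semiring.Exp as Exp
open import Data.Bool.Base using (if_then_else_)
open import Data.Fin.Base using (Fin; zero; suc)
open import Data.Fin.Subset using (Subset; _∈_)
open import Data.Nat.Base using (ℕ; zero; suc; NonZero)
open import Data.Product.Base using (∃; ∃₂; _×_)
open import Data.Sum.Base using (_⊎_)
open import Data.Vec.Base using (lookup)
open import Data.Vec.Functional using (Vector)
import Data.Vec.Functional.Relation.Binary.Equality.Setoid as VecEq
open import Function.Base using (_∘_)
open import Function.Definitions using (Injective)
open import Relation.Binary.Bundles using (DecTotalOrder)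
import Relation.Binary.Properties.DecTotalOrder as DecTotalOrderProperties
open import Relation.Binary.PropositionalEquality.Core using (_≡_)
open import Relation.Binary.Structures using (IsDecTotalOrder)
open import Relation.Nullary.Negation using (¬_)

-- The real numbers, axiomatised classically as a complete ordered field, which
-- is unique up to isomorphism.  Inverse and supremum are total functions about
-- which nothing is assumed at 0, respectively at predicates that are empty or
-- unbounded above.
record CompleteOrderedField : Set₁ where
  infix 4 _≤_
  infix 8 _⁻¹

  field
    commutativeRing : CommutativeRing 0ℓ 0ℓ

  open CommutativeRing commutativeRing public

  field
    _≤_             : Carrier → Carrier → Set
    isDecTotalOrder : IsDecTotalOrder _≈_ _≤_
    +-monoʳ-≤       : ∀ x {y z} → y ≤ z → x + y ≤ x + z
    *-nonNeg        : ∀ {x y} → 0# ≤ x → 0# ≤ y → 0# ≤ x * y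
    0≉1             : ¬ (0# ≈ 1#)
    _⁻¹             : Carrier → Carrier
    ⁻¹-inverseʳ     : ∀ {x} → ¬ (x ≈ 0#) → x * x ⁻¹ ≈ 1#

  UpperBound : (Carrier → Set) → Carrier → Set
  UpperBound A b = ∀ {x} → A x → x ≤ b

  field
    sup       : (Carrier → Set) → Carrier
    sup-upper : ∀ {A} → ∃ (UpperBound A) → UpperBound A (sup A)
    sup-least : ∀ {A} → ∃ A → ∀ {b} → UpperBound A b → sup A ≤ b

  decTotalOrder : DecTotalOrder 0ℓ 0ℓ 0ℓ
  decTotalOrder = record { isDecTotalOrder = isDecTotalOrder }

  open DecTotalOrderProperties decTotalOrder public using (_<_)
  open Min (DecTotalOrder.totalOrder decTotalOrder) public using (_⊓_)
  open Mult +-monoid public using () renaming (_×_ to _·_)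
  open Sum +-monoid public using (sum)
  open Exp semiring public using (_^_)

  infixl 7 _/_

  _/_ : Carrier → Carrier → Carrier
  x / y = x * y ⁻¹

  fromℕ : ℕ → Carrier
  fromℕ n = n · 1#

module Clustering (R : CompleteOrderedField) where
  open CompleteOrderedField R hiding (zero) renaming (Carrier to ℝ)

  -- Used only for x ≥ 0.
  √_ : ℝ → ℝ
  √ x = sup λ y → 0# ≤ y × y * y ≤ x

  -- Real powers x^z for x ≥ 0 and z > 0: the supremum of the rational powers
  -- x^(m/n) over m/n ≤ z when 1 ≤ x, and over m/n ≥ z when x ≤ 1 (where
  -- q ↦ x^q is nonincreasing).  The condition yⁿ ≤ xᵐ says y ≤ x^(m/n), for the
  -- denominator n = suc n′.  For such x and z the set is nonempty and bounded.
  infixr 8 _^ʳ_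

  _^ʳ_ : ℝ → ℝ → ℝ
  x ^ʳ z = sup λ y → 0# ≤ y × ∃₂ λ m n′ →
    y ^ suc n′ ≤ x ^ m ×
    ((1# ≤ x × fromℕ m ≤ fromℕ (suc n′) * z) ⊎
     (x ≤ 1# × fromℕ (suc n′) * z ≤ fromℕ m))

  Point : ℕ → Set
  Point D = Vector ℝ D

  ‖_-_‖ : ∀ {D} → Point D → Point D → ℝ
  ‖ p - c ‖ = √ sum λ i → (p i - c i) ^ 2

  -- A set of n points is given by an enumeration without repetitions.
  Distinct : ∀ {D n} → Vector (Point D) n → Set
  Distinct = Injective _≡_ (VecEq._≋_ setoid)

  minimum : ∀ {k} → .{{NonZero k}} → Vector ℝ k → ℝ
  minimum {suc zero}    v = v zero
  minimum {suc (suc k)} v = v zero ⊓ minimum (v ∘ suc)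

  module _ {D k n : ℕ} .{{_ : NonZero k}} (z : ℝ) (P : Vector (Point D) n) where

    pointCost : Vector (Point D) k → Fin n → ℝ
    pointCost C i = minimum λ j → ‖ P i - C j ‖ ^ʳ z

    cost : Vector (Point D) k → ℝ
    cost C = sum (pointCost C)

    -- Subsets of P are subsets of its index set; only the values of w on S
    -- matter.
    weightedCost : Subset n → (Fin n → ℝ) → Vector (Point D) k → ℝ
    weightedCost S w C =
      sum λ i → if lookup S i then w i * pointCost C i else 0#

  record IsCoreset {D n} (k : ℕ) .{{_ : NonZero k}} (z ε : ℝ)
                   (P : Vector (Point D) n) (S : Subset n) (w : Fin n → ℝ)
                   : Set where
    field
      weight-nonNeg : ∀ {i} → i ∈ S → 0# ≤ w i
      lower : ∀ (C : Vector (Point D) k) → Distinct C →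
              (1# - ε) * cost z P C ≤ weightedCost z P S w C
      upper : ∀ (C : Vector (Point D) k) → Distinct C →
              weightedCost z P S w C ≤ (1# + ε) * cost z P C

-- The dataset consists of k regular simplices with d vertices 4j e₀ + 2eᵢ each.
-- All its points have the same distance to the centers 4j e₀, so a coreset has
-- total weight at most (1 + ε) d k.  Now move every center by ±10ε along each of
-- the d directions eᵢ, with the sign + exactly when the corresponding vertex
-- belongs to the coreset S.  The cost of a point outside S then exceeds that of
-- a point of S by a factor of at least 1 + 5ε, because z ≥ 1 and the displacement
-- has length 10ε√d ≤ 1.  The weighted cost only sees the cheaper points, so it is
-- too small unless S contains a tenth of the dataset.

module Submission where

import Algebra.Construct.NaturalChoice.Min as Min
import Algebra.Properties.CommutativeSemiring.Exp as Exp
import Algebra.Properties.Ring as RingProperties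
import Algebra.Properties.Semiring.Mult as Mult
import Algebra.Properties.Semiring.Sum as Sum
import Algebra.Solver.Ring as Solver
open import Algebra.Solver.Ring.AlmostCommutativeRing
  using (fromCommutativeRing; _-Raw-AlmostCommutative⟶_)
open import Data.Bool.Base using (Bool; true; false; if_then_else_)
open import Data.Fin.Base using (Fin; zero; suc; toℕ; combine; remQuot)
open import Data.Fin.Properties
  using (toℕ-injective; combine-remQuot) renaming (_≟_ to _≟ᶠ_)
open import Data.Fin.Subset using (Subset; ∣_∣)
open import Data.Integer.Base as ℤ using (ℤ; +_; -[1+_]; _⊖_)
import Data.Integer.Properties as ℤ
open import Data.Maybe.Base using (just; nothing)
open import Data.Nat.Base as ℕ using (ℕ; zero; suc; NonZero; z≤n; s≤s)
import Data.Nat.Properties as ℕ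
open import Data.Product.Base using (∃; ∃₂; _×_; _,_; proj₁; proj₂)
open import Data.Sum.Base using (_⊎_; inj₁; inj₂)
open import Data.Vec.Base using (lookup; []; _∷_)
open import Data.Vec.Properties using (lookup⇒[]=)
open import Data.Vec.Functional using (Vector; updateAt) renaming (_∷_ to _∷ᶠ_)
open import Data.Vec.Functional.Properties using (updateAt-updates; updateAt-minimal)
open import Defs
open import Function.Base using (_∘_; _$_)
open import Relation.Binary.Bundles using (DecTotalOrder)
open import Relation.Binary.Definitions using (WeaklyDecidable)
open import Relation.Binary.PropositionalEquality.Core as ≡ using (_≡_; _≢_)
import Relation.Binary.Reasoning.PartialOrder as ≤-Reasoning
open import Relation.Nullary.Decidable.Core using (yes; no; decidable-stable)
open import Relation.Nullary.Negation using (¬_; contradiction)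

-- Integer coefficients for the ring solver.

module IntegerSolver (R : CompleteOrderedField) where
  open CompleteOrderedField R hiding (zero) renaming (Carrier to ℝ)
  open Mult semiring using (×-homo-+; ×1-homo-*)
  open RingProperties ring
  open import Relation.Binary.Reasoning.Setoid setoid

  -- The value at 1 is 1# itself, and not fromℕ 1 = 1# + 0#, so that the solver
  -- recognises both 1# and the numerals fromℕ n with n ≥ 2.
  fromℤ : ℤ → ℝ
  fromℤ (+ 1)      = 1#
  fromℤ (+ n)      = fromℕ n
  fromℤ -[1+ n ]   = - fromℕ (suc n)

  fromℤ-+ : ∀ n → fromℤ (+ n) ≈ fromℕ n
  fromℤ-+ 0             = refl
  fromℤ-+ 1             = sym (+-identityʳ 1#)
  fromℤ-+ (suc (suc n)) = refl

  fromℤ-neg : ∀ i → fromℤ (ℤ.- i) ≈ - fromℤ i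
  fromℤ-neg (+ 0)           = sym -0#≈0#
  fromℤ-neg (+ 1)           = -‿cong (+-identityʳ 1#)
  fromℤ-neg (+ suc (suc n)) = refl
  fromℤ-neg -[1+ n ]        = trans (fromℤ-+ (suc n)) (sym (-‿involutive _))

  fromℤ-⊖ : ∀ m n → fromℤ (m ⊖ n) ≈ fromℕ m - fromℕ n
  fromℤ-⊖ zero    zero    = sym (-‿inverseʳ 0#)
  fromℤ-⊖ zero    (suc n) = sym (+-identityˡ _)
  fromℤ-⊖ (suc m) zero    = begin
    fromℤ (+ suc m)        ≈⟨ fromℤ-+ (suc m) ⟩
    fromℕ (suc m)          ≈⟨ +-identityʳ _ ⟨
    fromℕ (suc m) + 0#     ≈⟨ +-congˡ -0#≈0# ⟨
    fromℕ (suc m) - 0#     ∎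
  fromℤ-⊖ (suc m) (suc n) = begin
    fromℤ (suc m ⊖ suc n)                ≡⟨ ≡.cong fromℤ (ℤ.[1+m]⊖[1+n]≡m⊖n m n) ⟩
    fromℤ (m ⊖ n)                        ≈⟨ fromℤ-⊖ m n ⟩
    fromℕ m - fromℕ n                    ≈⟨ +-congʳ (+-identityʳ _) ⟨
    fromℕ m + 0# - fromℕ n               ≈⟨ +-congʳ (+-congˡ (-‿inverseʳ 1#)) ⟨
    fromℕ m + (1# - 1#) - fromℕ n        ≈⟨ +-congʳ (+-assoc _ _ _) ⟨
    fromℕ m + 1# - 1# - fromℕ n          ≈⟨ +-congʳ (+-congʳ (+-comm _ _)) ⟩
    fromℕ (suc m) - 1# - fromℕ n         ≈⟨ +-assoc _ _ _ ⟩
    fromℕ (suc m) + (- 1# - fromℕ n)     ≈⟨ +-congˡ (-‿+-comm _ _) ⟩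
    fromℕ (suc m) - fromℕ (suc n)        ∎

  fromℤ-homo-+ : ∀ i j → fromℤ (i ℤ.+ j) ≈ fromℤ i + fromℤ j
  fromℤ-homo-+ (+ m) (+ n) = begin
    fromℤ (+ (m ℕ.+ n))        ≈⟨ fromℤ-+ (m ℕ.+ n) ⟩
    fromℕ (m ℕ.+ n)            ≈⟨ ×-homo-+ 1# m n ⟩
    fromℕ m + fromℕ n          ≈⟨ +-cong (fromℤ-+ m) (fromℤ-+ n) ⟨
    fromℤ (+ m) + fromℤ (+ n)  ∎
  fromℤ-homo-+ (+ m) -[1+ n ] =
    trans (fromℤ-⊖ m (suc n)) (+-congʳ (sym (fromℤ-+ m)))
  fromℤ-homo-+ -[1+ m ] (+ n) =
    trans (fromℤ-⊖ n (suc m)) (trans (+-comm _ _) (+-congˡ (sym (fromℤ-+ n))))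
  fromℤ-homo-+ -[1+ m ] -[1+ n ] = begin
    - fromℕ (suc (suc (m ℕ.+ n)))          ≡⟨ ≡.cong (-_ ∘ fromℕ ∘ suc) (ℕ.+-suc m n) ⟨
    - fromℕ (suc m ℕ.+ suc n)              ≈⟨ -‿cong (×-homo-+ 1# (suc m) (suc n)) ⟩
    - (fromℕ (suc m) + fromℕ (suc n))      ≈⟨ -‿+-comm _ _ ⟨
    - fromℕ (suc m) - fromℕ (suc n)        ∎

  fromℤ-homo-*-+ : ∀ m n → fromℤ (+ m ℤ.* + n) ≈ fromℤ (+ m) * fromℤ (+ n)
  fromℤ-homo-*-+ m n = begin
    fromℤ (+ m ℤ.* + n)        ≡⟨ ≡.cong fromℤ (ℤ.pos-* m n) ⟨
    fromℤ (+ (m ℕ.* n))        ≈⟨ fromℤ-+ (m ℕ.* n) ⟩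
    fromℕ (m ℕ.* n)            ≈⟨ ×1-homo-* m n ⟩
    fromℕ m * fromℕ n          ≈⟨ *-cong (fromℤ-+ m) (fromℤ-+ n) ⟨
    fromℤ (+ m) * fromℤ (+ n)  ∎

  -- Together with commutativity, this sign change produces every case of `fromℤ-homo-*` from the
  -- product of two nonnegative integers.
  fromℤ-homo-*-neg : ∀ i j → fromℤ (i ℤ.* j) ≈ fromℤ i * fromℤ j →
                     fromℤ (i ℤ.* ℤ.- j) ≈ fromℤ i * fromℤ (ℤ.- j)
  fromℤ-homo-*-neg i j ij = begin
    fromℤ (i ℤ.* ℤ.- j)      ≡⟨ ≡.cong fromℤ (ℤ.neg-distribʳ-* i j) ⟨
    fromℤ (ℤ.- (i ℤ.* j))    ≈⟨ fromℤ-neg (i ℤ.* j) ⟩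
    - fromℤ (i ℤ.* j)        ≈⟨ -‿cong ij ⟩
    - (fromℤ i * fromℤ j)    ≈⟨ -‿distribʳ-* _ _ ⟩
    fromℤ i * - fromℤ j      ≈⟨ *-congˡ (fromℤ-neg j) ⟨
    fromℤ i * fromℤ (ℤ.- j)  ∎

  fromℤ-homo-* : ∀ i j → fromℤ (i ℤ.* j) ≈ fromℤ i * fromℤ j
  fromℤ-homo-* (+ m)    (+ n)    = fromℤ-homo-*-+ m n
  fromℤ-homo-* (+ m)    -[1+ n ] = fromℤ-homo-*-neg (+ m) (+ suc n) (fromℤ-homo-*-+ m (suc n))
  fromℤ-homo-* -[1+ m ] j        = begin
    fromℤ (-[1+ m ] ℤ.* j)       ≡⟨ ≡.cong fromℤ (ℤ.*-comm -[1+ m ] j) ⟩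
    fromℤ (j ℤ.* -[1+ m ])       ≈⟨ fromℤ-homo-*-neg j (+ suc m) (j*+ j) ⟩
    fromℤ j * fromℤ -[1+ m ]     ≈⟨ *-comm _ _ ⟩
    fromℤ -[1+ m ] * fromℤ j     ∎
    where
    j*+ : ∀ j → fromℤ (j ℤ.* + suc m) ≈ fromℤ j * fromℤ (+ suc m)
    j*+ (+ n)    = fromℤ-homo-*-+ n (suc m)
    j*+ -[1+ n ] = begin
      fromℤ (-[1+ n ] ℤ.* + suc m)        ≡⟨ ≡.cong fromℤ (ℤ.*-comm -[1+ n ] (+ suc m)) ⟩
      fromℤ (+ suc m ℤ.* -[1+ n ])        ≈⟨ fromℤ-homo-*-neg (+ suc m) (+ suc n) (fromℤ-homo-*-+ (suc m) (suc n)) ⟩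
      fromℤ (+ suc m) * fromℤ -[1+ n ]    ≈⟨ *-comm _ _ ⟩
      fromℤ -[1+ n ] * fromℤ (+ suc m)    ∎

  fromℤ-homomorphism : ℤ.+-*-rawRing -Raw-AlmostCommutative⟶ fromCommutativeRing commutativeRing
  fromℤ-homomorphism = record
    { ⟦_⟧    = fromℤ
    ; +-homo = fromℤ-homo-+
    ; *-homo = fromℤ-homo-*
    ; -‿homo = fromℤ-neg
    ; 0-homo = refl
    ; 1-homo = refl
    }

  fromℤ-≟ : WeaklyDecidable (λ i j → fromℤ i ≈ fromℤ j)
  fromℤ-≟ i j with i ℤ.≟ j
  ... | yes ≡.refl = just refl
  ... | no  _      = nothing

  open Solver ℤ.+-*-rawRing (fromCommutativeRing commutativeRing) fromℤ-homomorphism fromℤ-≟ public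
    using (Polynomial; solve; con; _:+_; _:*_; _:-_; :-_; _:^_; _:=_)

  :# : ∀ {m} → ℕ → Polynomial m
  :# n = con (+ n)

-- Order, powers, suprema and sums in an ordered field.

module OrderedField (R : CompleteOrderedField) where
  open CompleteOrderedField R hiding (zero) renaming (Carrier to ℝ)
  open DecTotalOrder decTotalOrder public
    using (_≤?_; total; antisym; ≤-respˡ-≈; ≤-respʳ-≈; poset)
    renaming (refl to ≤-refl; reflexive to ≤-reflexive; trans to ≤-trans)
  open IntegerSolver R
  open ≤-Reasoning poset

  ≤-stable : ∀ {x y} → ¬ ¬ (x ≤ y) → x ≤ y
  ≤-stable = decidable-stable (_ ≤? _)

  +-monoˡ-≤ : ∀ z {x y} → x ≤ y → x + z ≤ y + z
  +-monoˡ-≤ z x≤y = ≤-respˡ-≈ (+-comm _ _) (≤-respʳ-≈ (+-comm _ _) (+-monoʳ-≤ z x≤y))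

  +-mono-≤ : ∀ {x y u v} → x ≤ y → u ≤ v → x + u ≤ y + v
  +-mono-≤ x≤y u≤v = ≤-trans (+-monoˡ-≤ _ x≤y) (+-monoʳ-≤ _ u≤v)

  +-nonNeg : ∀ {x y} → 0# ≤ x → 0# ≤ y → 0# ≤ x + y
  +-nonNeg 0≤x 0≤y = ≤-respˡ-≈ (+-identityˡ 0#) (+-mono-≤ 0≤x 0≤y)

  ≤⇒0≤- : ∀ {x y} → x ≤ y → 0# ≤ y - x
  ≤⇒0≤- {x} x≤y = ≤-respˡ-≈ (-‿inverseʳ x) (+-monoˡ-≤ (- x) x≤y)

  -- Polynomial inequalities below are certified by a slack `e`: nonnegative by construction, with
  -- an identity left to the ring solver.
  ≤-by : ∀ {x y} e → 0# ≤ e → x + e ≈ y → x ≤ y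
  ≤-by {x} {y} e 0≤e x+e≈y = begin
    x       ≈⟨ +-identityʳ x ⟨
    x + 0#  ≤⟨ +-monoʳ-≤ x 0≤e ⟩
    x + e   ≈⟨ x+e≈y ⟩
    y       ∎

  *-monoʳ-≤ : ∀ {z} → 0# ≤ z → ∀ {x y} → x ≤ y → z * x ≤ z * y
  *-monoʳ-≤ {z} 0≤z {x} {y} x≤y = ≤-by _ (*-nonNeg 0≤z (≤⇒0≤- x≤y))
    (solve 3 (λ x y z → z :* x :+ z :* (y :- x) := z :* y) refl x y z)

  *-monoˡ-≤ : ∀ {z} → 0# ≤ z → ∀ {x y} → x ≤ y → x * z ≤ y * z
  *-monoˡ-≤ 0≤z x≤y = ≤-respˡ-≈ (*-comm _ _) (≤-respʳ-≈ (*-comm _ _) (*-monoʳ-≤ 0≤z x≤y))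

  *-mono-≤ : ∀ {x y u v} → 0# ≤ x → 0# ≤ u → x ≤ y → u ≤ v → x * u ≤ y * v
  *-mono-≤ 0≤x 0≤u x≤y u≤v = ≤-trans (*-monoˡ-≤ 0≤u x≤y) (*-monoʳ-≤ (≤-trans 0≤x x≤y) u≤v)

  0≤x*x : ∀ x → 0# ≤ x * x
  0≤x*x x with total 0# x
  ... | inj₁ 0≤x = *-nonNeg 0≤x 0≤x
  ... | inj₂ x≤0 = ≤-respʳ-≈ (solve 1 (λ x → (:# 0 :- x) :* (:# 0 :- x) := x :* x) refl x)
                     (*-nonNeg (≤⇒0≤- x≤0) (≤⇒0≤- x≤0))

  0≤1 : 0# ≤ 1#
  0≤1 = ≤-respʳ-≈ (*-identityˡ 1#) (0≤x*x 1#)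

  1≰0 : ¬ (1# ≤ 0#)
  1≰0 1≤0 = 0≉1 (antisym 0≤1 1≤0)

  fromℕ-nonNeg : ∀ n → 0# ≤ fromℕ n
  fromℕ-nonNeg zero    = ≤-refl
  fromℕ-nonNeg (suc n) = +-nonNeg 0≤1 (fromℕ-nonNeg n)

  fromℕ-mono-≤ : ∀ {m n} → m ℕ.≤ n → fromℕ m ≤ fromℕ n
  fromℕ-mono-≤ {n = n} z≤n       = fromℕ-nonNeg n
  fromℕ-mono-≤ (s≤s {m} {n} m≤n) = +-monoʳ-≤ 1# (fromℕ-mono-≤ {m} {n} m≤n)

  1≤fromℕ : ∀ n .{{_ : NonZero n}} → 1# ≤ fromℕ n
  1≤fromℕ (suc n) = ≤-by (fromℕ n) (fromℕ-nonNeg n) refl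

  1+x≰x : ∀ {x} → ¬ (1# + x ≤ x)
  1+x≰x {x} 1+x≤x = 1≰0 $ ≤-respˡ-≈ (solve 1 (λ x → :# 1 :+ x :- x := :# 1) refl x)
    (≤-respʳ-≈ (-‿inverseʳ x) (+-monoˡ-≤ (- x) 1+x≤x))

  fromℕ-cancel-≤ : ∀ {m n} → fromℕ m ≤ fromℕ n → m ℕ.≤ n
  fromℕ-cancel-≤ {m} {n} m≤n with m ℕ.≤? n
  ... | yes m≤n = m≤n
  ... | no  m≰n = contradiction (≤-trans (fromℕ-mono-≤ {suc n} {m} (ℕ.≰⇒> m≰n)) m≤n) 1+x≰x

  1≤⇒0≤ : ∀ {x} → 1# ≤ x → 0# ≤ x
  1≤⇒0≤ = ≤-trans 0≤1

  1≤* : ∀ {x y} → 1# ≤ x → 1# ≤ y → 1# ≤ x * y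
  1≤* 1≤x 1≤y = ≤-respˡ-≈ (*-identityˡ 1#) (*-mono-≤ 0≤1 0≤1 1≤x 1≤y)

  1≤^ : ∀ {x} → 1# ≤ x → ∀ n → 1# ≤ x ^ n
  1≤^ 1≤x zero    = ≤-refl
  1≤^ 1≤x (suc n) = 1≤* 1≤x (1≤^ 1≤x n)

  x≤r*x : ∀ {r x} → 1# ≤ r → 0# ≤ x → x ≤ r * x
  x≤r*x 1≤r 0≤x = ≤-respˡ-≈ (*-identityˡ _) (*-monoˡ-≤ 0≤x 1≤r)

  ^-nonNeg : ∀ {x} → 0# ≤ x → ∀ n → 0# ≤ x ^ n
  ^-nonNeg 0≤x zero    = 0≤1
  ^-nonNeg 0≤x (suc n) = *-nonNeg 0≤x (^-nonNeg 0≤x n)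

  ^-monoˡ-≤ : ∀ {x y} → 0# ≤ x → x ≤ y → ∀ n → x ^ n ≤ y ^ n
  ^-monoˡ-≤ 0≤x x≤y zero    = ≤-refl
  ^-monoˡ-≤ 0≤x x≤y (suc n) = *-mono-≤ 0≤x (^-nonNeg 0≤x n) x≤y (^-monoˡ-≤ 0≤x x≤y n)

  ^-monoʳ-≤ : ∀ {x m n} → 1# ≤ x → m ℕ.≤ n → x ^ m ≤ x ^ n
  ^-monoʳ-≤ {n = n} 1≤x z≤n       = 1≤^ 1≤x n
  ^-monoʳ-≤ 1≤x (s≤s {m} {n} m≤n) = *-monoʳ-≤ (1≤⇒0≤ 1≤x) (^-monoʳ-≤ {m = m} {n} 1≤x m≤n)

  -- If `y ≤ x`, then `y - x` is the sum of the nonnegative terms `(r - 1) * (x - y)` and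
  -- `r * y - r * x`.
  *-cancelˡ-≤ : ∀ {r x y} → 1# ≤ r → r * x ≤ r * y → x ≤ y
  *-cancelˡ-≤ {r} {x} {y} 1≤r rx≤ry with total x y
  ... | inj₁ x≤y = x≤y
  ... | inj₂ y≤x = ≤-by _ (+-nonNeg (*-nonNeg (≤⇒0≤- 1≤r) (≤⇒0≤- y≤x)) (≤⇒0≤- rx≤ry))
    (solve 3 (λ r x y → x :+ ((r :- :# 1) :* (x :- y) :+ (r :* y :- r :* x)) := y) refl r x y)

  -- If `b ≤ x`, then `b ^ n * x ≤ x ^ n * x ≤ b ^ n * b`, and `b ^ n`, being at least 1, cancels.
  ^-cancelˡ-≤ : ∀ {x b} → 1# ≤ b → ∀ n → x ^ suc n ≤ b ^ suc n → x ≤ b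
  ^-cancelˡ-≤ {x} {b} 1≤b n xⁿ≤bⁿ with total x b
  ... | inj₁ x≤b = x≤b
  ... | inj₂ b≤x = *-cancelˡ-≤ (1≤^ 1≤b n) (begin
    b ^ n * x      ≤⟨ *-monoˡ-≤ (1≤⇒0≤ (≤-trans 1≤b b≤x)) (^-monoˡ-≤ (1≤⇒0≤ 1≤b) b≤x n) ⟩
    x ^ n * x      ≈⟨ *-comm _ _ ⟩
    x ^ suc n      ≤⟨ xⁿ≤bⁿ ⟩
    b ^ suc n      ≈⟨ *-comm _ _ ⟩
    b ^ n * b      ∎)

  1≤⇒≉0 : ∀ {x} → 1# ≤ x → ¬ (x ≈ 0#)
  1≤⇒≉0 1≤x x≈0 = 1≰0 (≤-respʳ-≈ x≈0 1≤x)

  ⁻¹-nonNeg : ∀ {x} → 1# ≤ x → 0# ≤ x ⁻¹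
  ⁻¹-nonNeg {x} 1≤x with total 0# (x ⁻¹)
  ... | inj₁ 0≤x⁻¹ = 0≤x⁻¹
  ... | inj₂ x⁻¹≤0 = contradiction
    (≤-respˡ-≈ (⁻¹-inverseʳ (1≤⇒≉0 1≤x)) (≤-respʳ-≈ (zeroʳ x) (*-monoʳ-≤ (1≤⇒0≤ 1≤x) x⁻¹≤0)))
    1≰0

  r*x≤y⇒x≤r⁻¹*y : ∀ {r x y} → 1# ≤ r → r * x ≤ y → x ≤ r ⁻¹ * y
  r*x≤y⇒x≤r⁻¹*y {r} {x} {y} 1≤r rx≤y = begin
    x               ≈⟨ *-identityˡ x ⟨
    1# * x          ≈⟨ *-congʳ (⁻¹-inverseʳ (1≤⇒≉0 1≤r)) ⟨
    r * r ⁻¹ * x    ≈⟨ solve 3 (λ r s x → r :* s :* x := s :* (r :* x)) refl r (r ⁻¹) x ⟩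
    r ⁻¹ * (r * x)  ≤⟨ *-monoʳ-≤ (⁻¹-nonNeg 1≤r) rx≤y ⟩
    r ⁻¹ * y        ∎

  r*r⁻¹*x≈x : ∀ {r} x → 1# ≤ r → r * (r ⁻¹ * x) ≈ x
  r*r⁻¹*x≈x x 1≤r = trans (sym (*-assoc _ _ _))
    (trans (*-congʳ (⁻¹-inverseʳ (1≤⇒≉0 1≤r))) (*-identityˡ x))

  -- Only doubly negated: no witness can be extracted from sup.  As _≤_ is
  -- stable, this is enough to bound the sets below.
  archimedean : ∀ x → ¬ ¬ ∃ λ n → x ≤ fromℕ n
  archimedean x unbounded = 1+x≰x {s - 1#}
    (≤-respˡ-≈ (solve 1 (λ s → s := :# 1 :+ (s :- :# 1)) refl s)
      (sup-least (_ , 0 , refl) below))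
    where
    IsNatural : ℝ → Set
    IsNatural y = ∃ λ n → y ≈ fromℕ n
    s = sup IsNatural

    natural≤x : ∀ n → fromℕ n ≤ x
    natural≤x n with total (fromℕ n) x
    ... | inj₁ n≤x = n≤x
    ... | inj₂ x≤n = contradiction (n , x≤n) unbounded

    bounded : ∃ (UpperBound IsNatural)
    bounded = x , λ (n , y≈n) → ≤-respˡ-≈ (sym y≈n) (natural≤x n)

    below : UpperBound IsNatural (s - 1#)
    below {y} (n , y≈n) = begin
      y                  ≈⟨ y≈n ⟩
      fromℕ n            ≈⟨ solve 1 (λ m → m := :# 1 :+ m :- :# 1) refl (fromℕ n) ⟩
      fromℕ (suc n) - 1# ≤⟨ +-monoˡ-≤ (- 1#) (sup-upper bounded (suc n , refl)) ⟩
      s - 1#             ∎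

  ≤-sup : ∀ {A} → ¬ ¬ ∃ (UpperBound A) → ∀ {x} → A x → x ≤ sup A
  ≤-sup bounded Ax = ≤-stable λ x≰s → bounded λ b → x≰s (sup-upper b Ax)

  -- Every `x` in `A` is at most `r ⁻¹ * sup B`. As `√_` and `_^ʳ_` are suprema, their scaling
  -- estimates reduce to scaling the members of the defining sets.
  *-sup-≤ : ∀ {A B r} → 1# ≤ r → ∃ A → ¬ ¬ ∃ (UpperBound B) →
            (∀ {x} → A x → B (r * x)) → r * sup A ≤ sup B
  *-sup-≤ {A} {B} {r} 1≤r A≠∅ B-bounded A⇒B = begin
    r * sup A            ≤⟨ *-monoʳ-≤ (1≤⇒0≤ 1≤r) (sup-least A≠∅ λ Ax →
                              r*x≤y⇒x≤r⁻¹*y 1≤r (≤-sup B-bounded (A⇒B Ax))) ⟩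
    r * (r ⁻¹ * sup B)   ≈⟨ r*r⁻¹*x≈x _ 1≤r ⟩
    sup B                ∎

  sum-mono-≤ : ∀ {n} {x y : Vector ℝ n} → (∀ i → x i ≤ y i) → sum x ≤ sum y
  sum-mono-≤ {zero}  x≤y = ≤-refl
  sum-mono-≤ {suc n} x≤y = +-mono-≤ (x≤y zero) (sum-mono-≤ (x≤y ∘ suc))

  sum-constant : ∀ n {x} → sum {n} (λ _ → x) ≈ fromℕ n * x
  sum-constant zero    {x} = sym (zeroˡ x)
  sum-constant (suc n) {x} = trans (+-congˡ (sum-constant n))
    (solve 2 (λ m x → x :+ m :* x := (:# 1 :+ m) :* x) refl (fromℕ n) x)

  -- The `n - ∣ S ∣` positions outside `S` contribute `y` each. Adding `fromℕ ∣ S ∣ * y` on the left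
  -- keeps this subtraction out of the induction.
  sum-if-∈ : ∀ {n} (S : Subset n) x y →
             sum (λ i → if lookup S i then x else y) + fromℕ ∣ S ∣ * y ≈
             fromℕ ∣ S ∣ * x + fromℕ n * y
  sum-if-∈ []          x y = solve 2 (λ x y → :# 0 :+ :# 0 :* y := :# 0 :* x :+ :# 0 :* y) refl x y
  sum-if-∈ {suc n} (true ∷ S)  x y =
    trans (solve 4 (λ Σ m x y → x :+ Σ :+ (:# 1 :+ m) :* y := Σ :+ m :* y :+ (x :+ y)) refl _ (fromℕ ∣ S ∣) x y)
      (trans (+-congʳ (sum-if-∈ S x y))
        (solve 4 (λ m n x y → m :* x :+ n :* y :+ (x :+ y) := (:# 1 :+ m) :* x :+ (:# 1 :+ n) :* y) refl
          (fromℕ ∣ S ∣) (fromℕ n) x y))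
  sum-if-∈ {suc n} (false ∷ S) x y =
    trans (+-assoc _ _ _) (trans (+-congˡ (sum-if-∈ S x y))
      (solve 4 (λ m n x y → y :+ (m :* x :+ n :* y) := m :* x :+ (:# 1 :+ n) :* y) refl
        (fromℕ ∣ S ∣) (fromℕ n) x y))

-- Square roots and real powers.

module Geometry (R : CompleteOrderedField) where
  open CompleteOrderedField R hiding (zero) renaming (Carrier to ℝ)
  open Clustering R
  open IntegerSolver R
  open OrderedField R
  open Mult semiring using (×1-homo-*)
  open Exp commutativeSemiring using (^-distrib-*; ^-assocʳ)
  open Min (DecTotalOrder.totalOrder decTotalOrder) using (x⊓y≤x; x⊓y≤y; ⊓-glb)
  open Sum semiring using (sum-cong-≋)
  open ≤-Reasoning poset

  √-bounded : ∀ {x} → 0# ≤ x → ∃ (UpperBound λ y → 0# ≤ y × y * y ≤ x)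
  √-bounded {x} 0≤x = 1# + x , λ {y} (0≤y , y²≤x) → bound 0≤y y²≤x
    where
    bound : ∀ {y} → 0# ≤ y → y * y ≤ x → y ≤ 1# + x
    bound {y} 0≤y y²≤x with total y 1#
    ... | inj₁ y≤1 = ≤-trans y≤1 (≤-by x 0≤x refl)
    ... | inj₂ 1≤y = begin
      y       ≤⟨ x≤r*x 1≤y 0≤y ⟩
      y * y   ≤⟨ y²≤x ⟩
      x       ≤⟨ ≤-by 1# 0≤1 (+-comm x 1#) ⟩
      1# + x  ∎

  √-*-≤ : ∀ {r x y} → 1# ≤ r → 0# ≤ x → r * r * x ≤ y → r * √ x ≤ √ y
  √-*-≤ {r} {x} {y} 1≤r 0≤x rrx≤y = *-sup-≤ 1≤r
    (0# , ≤-refl , ≤-respˡ-≈ (sym (zeroˡ 0#)) 0≤x)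
    (λ ¬b → ¬b (√-bounded (≤-trans (*-nonNeg 0≤r² 0≤x) rrx≤y)))
    λ {u} (0≤u , u²≤x) → *-nonNeg 0≤r 0≤u , (begin
      r * u * (r * u)    ≈⟨ solve 2 (λ r u → r :* u :* (r :* u) := r :* r :* (u :* u)) refl r u ⟩
      r * r * (u * u)    ≤⟨ *-monoʳ-≤ 0≤r² u²≤x ⟩
      r * r * x          ≤⟨ rrx≤y ⟩
      y                  ∎)
    where
    0≤r  = 1≤⇒0≤ 1≤r
    0≤r² = 0≤x*x r

  1≤√ : ∀ {x} → 1# ≤ x → 1# ≤ √ x
  1≤√ 1≤x = sup-upper (√-bounded (1≤⇒0≤ 1≤x)) (0≤1 , ≤-respˡ-≈ (sym (*-identityˡ 1#)) 1≤x)

  module _ {z : ℝ} (1≤z : 1# ≤ z) where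

    -- The set whose supremum is x ^ʳ z.
    RationalPowersBelow : ℝ → ℝ → Set
    RationalPowersBelow x y = 0# ≤ y × ∃₂ λ m n′ →
      y ^ suc n′ ≤ x ^ m ×
      ((1# ≤ x × fromℕ m ≤ fromℕ (suc n′) * z) ⊎
       (x ≤ 1# × fromℕ (suc n′) * z ≤ fromℕ m))

    n≤n*z : ∀ n → fromℕ n ≤ fromℕ n * z
    n≤n*z n = ≤-respʳ-≈ (*-comm _ _) (x≤r*x 1≤z (fromℕ-nonNeg n))

    -- For x ≥ 1 the exponent may be taken to be at least 1, as z ≥ 1.
    normalise : ∀ {x y} → 1# ≤ x → RationalPowersBelow x y → ∃₂ λ m n′ →
                suc n′ ℕ.≤ m × fromℕ m ≤ fromℕ (suc n′) * z × y ^ suc n′ ≤ x ^ m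
    normalise 1≤x (0≤y , m , n′ , yⁿ≤xᵐ , inj₁ (_ , m≤nz)) with ℕ.≤-total (suc n′) m
    ... | inj₁ n≤m = m , n′ , n≤m , m≤nz , yⁿ≤xᵐ
    ... | inj₂ m≤n = suc n′ , n′ , ℕ.≤-refl , n≤n*z (suc n′) , ≤-trans yⁿ≤xᵐ (^-monoʳ-≤ 1≤x m≤n)
    -- The branch for bases at most 1 meets `1# ≤ x` only at `x ≈ 1#`, where the exponent 1 serves
    -- as well.
    normalise {x} {y} 1≤x (0≤y , m , n′ , yⁿ≤xᵐ , inj₂ (x≤1 , _)) =
      suc n′ , n′ , ℕ.≤-refl , n≤n*z (suc n′) , (begin
        y ^ suc n′   ≤⟨ yⁿ≤xᵐ ⟩
        x ^ m        ≤⟨ ^-monoˡ-≤ (1≤⇒0≤ 1≤x) x≤1 m ⟩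
        1# ^ m       ≤⟨ ^-monoʳ-≤ ≤-refl (ℕ.m≤m+n m (suc n′)) ⟩
        1# ^ (m ℕ.+ suc n′)  ≤⟨ 1^≤1 (m ℕ.+ suc n′) ⟩
        1#           ≤⟨ 1≤^ 1≤x (suc n′) ⟩
        x ^ suc n′   ∎)
      where
      1^≤1 : ∀ n → 1# ^ n ≤ 1#
      1^≤1 zero    = ≤-refl
      1^≤1 (suc n) = ≤-respˡ-≈ (sym (*-identityˡ _)) (1^≤1 n)

    -- A natural number `N ≥ z` gives the bound `x ^ N`: with `n = suc n′`, from `y ^ n ≤ x ^ m` and
    -- `m ≤ n * z ≤ N * n` follows `y ^ n ≤ (x ^ N) ^ n`. The double negation is inherited from
    -- `archimedean`.
    ^ʳ-bounded : ∀ {x} → 1# ≤ x → ¬ ¬ ∃ (UpperBound (RationalPowersBelow x))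
    ^ʳ-bounded {x} 1≤x ¬bounded = archimedean z λ (N , z≤N) →
      ¬bounded (x ^ N , λ {y} p → bound N z≤N p)
      where
      bound : ∀ N → z ≤ fromℕ N → ∀ {y} → RationalPowersBelow x y → y ≤ x ^ N
      bound N z≤N {y} p with normalise 1≤x p
      ... | m , n′ , _ , m≤nz , yⁿ≤xᵐ = ^-cancelˡ-≤ (1≤^ 1≤x N) n′ (begin
        y ^ suc n′             ≤⟨ yⁿ≤xᵐ ⟩
        x ^ m                  ≤⟨ ^-monoʳ-≤ 1≤x (fromℕ-cancel-≤ {m} {N ℕ.* suc n′} m≤N*n) ⟩
        x ^ (N ℕ.* suc n′)     ≈⟨ ^-assocʳ x N (suc n′) ⟨
        (x ^ N) ^ suc n′       ∎)
        where
        m≤N*n : fromℕ m ≤ fromℕ (N ℕ.* suc n′)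
        m≤N*n = begin
          fromℕ m                     ≤⟨ m≤nz ⟩
          fromℕ (suc n′) * z          ≤⟨ *-monoʳ-≤ (fromℕ-nonNeg (suc n′)) z≤N ⟩
          fromℕ (suc n′) * fromℕ N    ≈⟨ *-comm _ _ ⟩
          fromℕ N * fromℕ (suc n′)    ≈⟨ ×1-homo-* N (suc n′) ⟨
          fromℕ (N ℕ.* suc n′)        ∎

    x∈RationalPowersBelow : ∀ {x} → 1# ≤ x → RationalPowersBelow x x
    x∈RationalPowersBelow 1≤x = 1≤⇒0≤ 1≤x , 1 , 0 , ≤-refl , inj₁ (1≤x , n≤n*z 1)

    -- Raising to the power `z` keeps at least the factor `r`, because `z` is at least 1: a member
    -- `u` with exponent `m / n ≥ 1` satisfies `(r * u) ^ n ≤ r ^ m * x ^ m ≤ y ^ m`.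
    ^ʳ-*-≤ : ∀ {r x y} → 1# ≤ r → 1# ≤ x → r * x ≤ y → r * x ^ʳ z ≤ y ^ʳ z
    ^ʳ-*-≤ {r} {x} {y} 1≤r 1≤x rx≤y = *-sup-≤ 1≤r (x , x∈RationalPowersBelow 1≤x) (^ʳ-bounded 1≤y) scaled
      where
      1≤y = ≤-trans (1≤* 1≤r 1≤x) rx≤y
      scaled : ∀ {u} → RationalPowersBelow x u → RationalPowersBelow y (r * u)
      scaled {u} p@(0≤u , _) with normalise 1≤x p
      ... | m , n′ , n≤m , m≤nz , uⁿ≤xᵐ = *-nonNeg (1≤⇒0≤ 1≤r) 0≤u , m , n′ , (begin
        (r * u) ^ suc n′          ≈⟨ ^-distrib-* r u (suc n′) ⟩
        r ^ suc n′ * u ^ suc n′   ≤⟨ *-mono-≤ (^-nonNeg (1≤⇒0≤ 1≤r) (suc n′)) (^-nonNeg 0≤u (suc n′)) (^-monoʳ-≤ 1≤r n≤m) uⁿ≤xᵐ ⟩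
        r ^ m * x ^ m             ≈⟨ ^-distrib-* r x m ⟨
        (r * x) ^ m               ≤⟨ ^-monoˡ-≤ (1≤⇒0≤ (1≤* 1≤r 1≤x)) rx≤y m ⟩
        y ^ m                     ∎) , inj₁ (1≤y , m≤nz)

    1≤^ʳ : ∀ {x} → 1# ≤ x → 1# ≤ x ^ʳ z
    1≤^ʳ 1≤x = ≤-trans 1≤x (≤-sup (^ʳ-bounded 1≤x) (x∈RationalPowersBelow 1≤x))

    -- A factor `r * r` between squared distances survives as a factor `r` between costs.
    √^ʳ-*-≤ : ∀ {r x y} → 1# ≤ r → 1# ≤ x → r * r * x ≤ y → r * (√ x) ^ʳ z ≤ (√ y) ^ʳ z
    √^ʳ-*-≤ 1≤r 1≤x rrx≤y = ^ʳ-*-≤ 1≤r (1≤√ 1≤x) (√-*-≤ 1≤r (1≤⇒0≤ 1≤x) rrx≤y)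

    √^ʳ-mono-≤ : ∀ {x y} → 1# ≤ x → x ≤ y → (√ x) ^ʳ z ≤ (√ y) ^ʳ z
    √^ʳ-mono-≤ {x} 1≤x x≤y = ≤-respˡ-≈ (*-identityˡ _) (√^ʳ-*-≤ ≤-refl 1≤x
      (≤-respˡ-≈ (solve 1 (λ x → x := :# 1 :* :# 1 :* x) refl x) x≤y))

  minimum≤ : ∀ {k} .{{_ : NonZero k}} (v : Vector ℝ k) j → minimum v ≤ v j
  minimum≤ {suc zero}    v zero    = ≤-refl
  minimum≤ {suc (suc k)} v zero    = x⊓y≤x _ _
  minimum≤ {suc (suc k)} v (suc j) = ≤-trans (x⊓y≤y _ _) (minimum≤ (v ∘ suc) j)

  ≤minimum : ∀ {k} .{{_ : NonZero k}} {v : Vector ℝ k} {x} → (∀ j → x ≤ v j) → x ≤ minimum v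
  ≤minimum {suc zero}    x≤v = x≤v zero
  ≤minimum {suc (suc k)} x≤v = ⊓-glb (x≤v zero) (≤minimum (x≤v ∘ suc))

  -- The vertices of the simplices.

  spike : ∀ {d} → Fin d → ℝ → Vector ℝ d
  spike i x = updateAt (λ _ → 0#) i (λ _ → x)

  spike-injective : ∀ {d} (i i′ : Fin d) {x} → 1# ≤ x → (∀ l → spike i x l ≈ spike i′ x l) → i ≡ i′
  spike-injective i i′ {x} 1≤x eq with i ≟ᶠ i′
  ... | yes i≡i′ = i≡i′
  ... | no  i≢i′ = contradiction x≈0 (1≤⇒≉0 1≤x)
    where
    x≈0 : x ≈ 0#
    x≈0 = ≡.subst₂ _≈_ (updateAt-updates i (λ _ → 0#)) (updateAt-minimal i i′ (λ _ → 0#) i≢i′) (eq i)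

  -- Besides the norm of `c`, only its coordinate `c i` enters the expanded square. Hence each
  -- coordinate of a displacement can be chosen for its own vertex.
  sum-spike : ∀ {d} (i : Fin d) x (c : Vector ℝ d) →
              sum (λ l → (spike i x l - c l) ^ 2) ≈ x * x - fromℕ 2 * (x * c i) + sum (λ l → c l * c l)
  sum-spike zero x c = trans
    (+-congˡ (sum-cong-≋ λ l → solve 1 (λ y → (:# 0 :- y) :^ 2 := y :* y) refl (c (suc l))))
    (solve 3 (λ x c Σ → (x :- c) :^ 2 :+ Σ := x :* x :- :# 2 :* (x :* c) :+ (c :* c :+ Σ)) refl x (c zero) _)
  sum-spike (suc i) x c = trans (+-congˡ (sum-spike i x (c ∘ suc)))
    (solve 4 (λ x c₀ c Σ → (:# 0 :- c₀) :^ 2 :+ (x :* x :- :# 2 :* (x :* c) :+ Σ)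
                        := x :* x :- :# 2 :* (x :* c) :+ (c₀ :* c₀ :+ Σ)) refl x (c zero) (c (suc i)) _)

  -- The spacing 4 keeps every vertex nearest to the center of its own group as
  -- long as centers are displaced by at most 1 in each coordinate.
  position : ∀ {k} → Fin k → ℝ
  position j = fromℕ 4 * fromℕ (toℕ j)

  position-injective : ∀ {k} (j j′ : Fin k) → position j ≈ position j′ → j ≡ j′
  position-injective j j′ eq = toℕ-injective (ℕ.≤-antisym (≤ⁿ j j′ (≤-reflexive eq)) (≤ⁿ j′ j (≤-reflexive (sym eq))))
    where
    ≤ⁿ : ∀ j j′ → position j ≤ position j′ → toℕ j ℕ.≤ toℕ j′
    ≤ⁿ j j′ p≤p′ = fromℕ-cancel-≤ {toℕ j} {toℕ j′} (*-cancelˡ-≤ (1≤fromℕ 4) p≤p′)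

  position-gap : ∀ {k} (j j′ : Fin k) → toℕ j ℕ.< toℕ j′ →
                 fromℕ 16 ≤ (position j′ - position j) * (position j′ - position j)
  position-gap j j′ j<j′ = begin
    fromℕ 16            ≈⟨ solve 0 (:# 16 := :# 4 :* :# 4) refl ⟩
    fromℕ 4 * fromℕ 4   ≤⟨ *-mono-≤ (fromℕ-nonNeg 4) (fromℕ-nonNeg 4) 4≤gap 4≤gap ⟩
    _                   ∎
    where
    4≤gap : fromℕ 4 ≤ position j′ - position j
    4≤gap = ≤-by _ (≤⇒0≤- (*-monoʳ-≤ (fromℕ-nonNeg 4) (fromℕ-mono-≤ {suc (toℕ j)} {toℕ j′} j<j′)))
      (solve 2 (λ m n → :# 4 :+ (:# 4 :* n :- :# 4 :* (:# 1 :+ m)) := :# 4 :* n :- :# 4 :* m) refl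
        (fromℕ (toℕ j)) (fromℕ (toℕ j′)))

  position-separated : ∀ {k} (j j′ : Fin k) → j ≢ j′ →
                       fromℕ 16 ≤ (position j - position j′) * (position j - position j′)
  position-separated j j′ j≢j′ with ℕ.≤-total (toℕ j) (toℕ j′)
  ... | inj₁ j≤j′ = ≤-respʳ-≈
    (solve 2 (λ p q → (q :- p) :* (q :- p) := (p :- q) :* (p :- q)) refl (position j) (position j′))
    (position-gap j j′ (ℕ.≤∧≢⇒< j≤j′ (j≢j′ ∘ toℕ-injective)))
  ... | inj₂ j′≤j = position-gap j′ j (ℕ.≤∧≢⇒< j′≤j (j≢j′ ∘ ≡.sym ∘ toℕ-injective))

  vertex : ∀ {k d} → Fin k × Fin d → Point (suc d)
  vertex (j , i) = position j ∷ᶠ spike i (fromℕ 2)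

  dataset : ∀ k d → Vector (Point (suc d)) (k ℕ.* d)
  dataset k d a = vertex (remQuot {k} d a)

  dataset-distinct : ∀ k d → Distinct (dataset k d)
  dataset-distinct k d {a} {b} eq = ≡.trans (≡.sym (combine-remQuot {k} d a))
    (≡.trans (≡.cong₂ combine (position-injective j j′ (eq zero)) (spike-injective i i′ (1≤fromℕ 2) (eq ∘ suc)))
      (combine-remQuot {k} d b))
    where
    j  = proj₁ (remQuot {k} d a)
    i  = proj₂ (remQuot {k} d a)
    j′ = proj₁ (remQuot {k} d b)
    i′ = proj₂ (remQuot {k} d b)

  -- Displaced centers and the cost of a vertex.

  centers : ∀ {k d} → (Fin k → Vector ℝ d) → Vector (Point (suc d)) k
  centers o j = position j ∷ᶠ o j

  -- Offsets leave the first coordinate alone, so the positions separate the centers.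
  centers-distinct : ∀ {k d} (o : Fin k → Vector ℝ d) → Distinct (centers o)
  centers-distinct o {j} {j′} eq = position-injective j j′ (eq zero)

  squaredDistance : ∀ {D} → Point D → Point D → ℝ
  squaredDistance p c = sum λ l → (p l - c l) ^ 2

  -- The squared distance from `2eᵢ` to an offset whose `i`-th coordinate is `x` and whose `d`
  -- coordinates all have square `κ`.
  ownSquaredDistance : ℕ → ℝ → ℝ → ℝ
  ownSquaredDistance d x κ = fromℕ 4 - fromℕ 4 * x + fromℕ d * κ

  module _ {k d : ℕ} .{{_ : NonZero k}} .{{_ : NonZero d}}
           {o : Fin k → Vector ℝ d} {κ : ℝ} (o²≈κ : ∀ j i → o j i * o j i ≈ κ)
           (-1≤o : ∀ j i → - 1# ≤ o j i) (o≤1 : ∀ j i → o j i ≤ 1#) where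

    -- A common square `κ` of all offset coordinates makes the norm term `d κ` the same for every
    -- center. This covers both uses: offsets 0 and offsets `±10ε`.
    squaredDistance-centers : ∀ j i j′ →
      squaredDistance (vertex {k} (j , i)) (centers o j′) ≈
      (position j - position j′) * (position j - position j′) + ownSquaredDistance d (o j′ i) κ
    squaredDistance-centers j i j′ = +-cong
      (solve 1 (λ x → x :^ 2 := x :* x) refl (position j - position j′))
      (trans (sum-spike i (fromℕ 2) (o j′)) (+-cong
        (solve 1 (λ x → :# 2 :* :# 2 :- :# 2 :* (:# 2 :* x) := :# 4 :- :# 4 :* x) refl (o j′ i))
        (trans (sum-cong-≋ (o²≈κ j′)) (sum-constant d))))

    -- In the `i`-th coordinate alone, vertex and center differ by `2 - x ≥ 1`, and `x² = κ ≤ d κ`.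
    -- The estimates `√^ʳ-*-≤` and `√^ʳ-mono-≤` take arguments at least 1.
    1≤own : ∀ j i → 1# ≤ ownSquaredDistance d (o j i) κ
    1≤own j i = ≤-by _
      (+-nonNeg (+-nonNeg (0≤x*x (1# - x)) (+-nonNeg (≤⇒0≤- (o≤1 j i)) (≤⇒0≤- (o≤1 j i)))) (≤⇒0≤- x²≤dκ))
      (solve 2 (λ x s → :# 1 :+ ((:# 1 :- x) :* (:# 1 :- x) :+ ((:# 1 :- x) :+ (:# 1 :- x)) :+ (s :- x :* x))
                     := :# 4 :- :# 4 :* x :+ s) refl x (fromℕ d * κ))
      where
      x = o j i
      x²≤dκ : x * x ≤ fromℕ d * κ
      x²≤dκ = ≤-trans (x≤r*x (1≤fromℕ d) (0≤x*x x)) (≤-reflexive (*-congˡ (o²≈κ j i)))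

    own-nearest : ∀ j i j′ → ownSquaredDistance d (o j i) κ ≤ squaredDistance (vertex {k} (j , i)) (centers o j′)
    own-nearest j i j′ = ≤-respʳ-≈ (sym (squaredDistance-centers j i j′)) nearest
      where
      x = o j i
      y = o j′ i
      gap = (position j - position j′) * (position j - position j′)
      nearest : ownSquaredDistance d x κ ≤ gap + ownSquaredDistance d y κ
      nearest with j ≟ᶠ j′
      ... | yes ≡.refl = ≤-by gap (0≤x*x _) (+-comm _ _)
      -- A foreign center adds at least 16 through the gap, while the change `4 * (x - y)` is at
      -- least -8, which leaves a slack of 8.
      ... | no  j≢j′   = ≤-by _
        (+-nonNeg (+-nonNeg (≤⇒0≤- (position-separated j j′ j≢j′)) (fromℕ-nonNeg 8))
          (*-nonNeg (fromℕ-nonNeg 4) (+-nonNeg (≤⇒0≤- (-1≤o j i)) (≤⇒0≤- (o≤1 j′ i)))))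
        (solve 4 (λ x y g s → :# 4 :- :# 4 :* x :+ s :+ (g :- :# 16 :+ :# 8 :+ :# 4 :* (x :- :- :# 1 :+ (:# 1 :- y)))
                           := g :+ (:# 4 :- :# 4 :* y :+ s)) refl x y gap (fromℕ d * κ))

    module _ {z : ℝ} (1≤z : 1# ≤ z) (a : Fin (k ℕ.* d)) where

      private
        j = proj₁ (remQuot {k} d a)
        i = proj₂ (remQuot {k} d a)
        own = ownSquaredDistance d (o j i) κ

      ≤pointCost : (√ own) ^ʳ z ≤ pointCost z (dataset k d) (centers o) a
      ≤pointCost = ≤minimum λ j′ → √^ʳ-mono-≤ 1≤z (1≤own j i) (own-nearest j i j′)

      pointCost≤ : pointCost z (dataset k d) (centers o) a ≤ (√ own) ^ʳ z
      pointCost≤ = ≤-trans (minimum≤ _ j) (√^ʳ-mono-≤ 1≤z (≤-trans (1≤own j i) (own-nearest j i j))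
        (≤-reflexive (trans (squaredDistance-centers j i j)
          (solve 2 (λ p s → (p :- p) :* (p :- p) :+ s := s) refl (position j) own))))

-- Inequalities between the constants.

module LowerBound (R : CompleteOrderedField) where
  open CompleteOrderedField R hiding (zero) renaming (Carrier to ℝ)
  open Clustering R
  open IntegerSolver R
  open OrderedField R
  open Geometry R
  open Mult semiring using (×1-homo-*)
  open Sum semiring using (*-distribˡ-sum)
  open ≤-Reasoning poset

  -- The displacement `10ε` squares to `100ε²`, so the hypothesis on `d` says that a center moves by
  -- at most 1 in total.
  tolerance-bound : ∀ {ε} d → 0# < ε → fromℕ d ≤ 1# / (fromℕ 100 * ε ^ 2) →
                    fromℕ d * ((fromℕ 10 * ε) * (fromℕ 10 * ε)) ≤ 1#
  tolerance-bound {ε} d (0≤ε , 0≉ε) d≤ = begin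
    fromℕ d * (τ * τ)   ≈⟨ *-congˡ τ²≈c ⟩
    fromℕ d * c         ≤⟨ *-monoˡ-≤ (≤-respʳ-≈ τ²≈c (0≤x*x τ)) d≤ ⟩
    1# * c ⁻¹ * c       ≈⟨ solve 2 (λ c i → :# 1 :* i :* c := c :* i) refl c (c ⁻¹) ⟩
    c * c ⁻¹            ≈⟨ ⁻¹-inverseʳ c≉0 ⟩
    1#                  ∎
    where
    τ = fromℕ 10 * ε
    c = fromℕ 100 * ε ^ 2
    τ²≈c : τ * τ ≈ c
    τ²≈c = solve 1 (λ ε → (:# 10 :* ε) :* (:# 10 :* ε) := :# 100 :* ε :^ 2) refl ε
    ε*ε⁻¹≈1 : ε * ε ⁻¹ ≈ 1#
    ε*ε⁻¹≈1 = ⁻¹-inverseʳ (0≉ε ∘ sym)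
    -- `_⁻¹` is specified only away from 0. If `c` vanished, multiplying it by `ε ⁻¹` twice would
    -- make 100 zero.
    c≉0 : ¬ (c ≈ 0#)
    c≉0 c≈0 = 1≤⇒≉0 (1≤fromℕ 100) (begin-equality
      fromℕ 100                            ≈⟨ solve 0 (:# 100 := :# 100 :* (:# 1 :* :# 1)) refl ⟩
      fromℕ 100 * (1# * 1#)                ≈⟨ *-congˡ (*-cong ε*ε⁻¹≈1 ε*ε⁻¹≈1) ⟨
      fromℕ 100 * (ε * ε ⁻¹ * (ε * ε ⁻¹))  ≈⟨ solve 2 (λ ε i → :# 100 :* (ε :* i :* (ε :* i)) := :# 100 :* ε :^ 2 :* (i :* i)) refl ε (ε ⁻¹) ⟩
      c * (ε ⁻¹ * ε ⁻¹)                    ≈⟨ *-congʳ c≈0 ⟩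
      0# * (ε ⁻¹ * ε ⁻¹)                   ≈⟨ zeroˡ _ ⟩
      0#                                   ∎)

  -- Applied to `10ε`, this keeps every displaced coordinate between -1 and 1 and makes `ε` at most
  -- 1/10.
  d*x²≤1⇒x≤1 : ∀ d .{{_ : NonZero d}} {x} → fromℕ d * (x * x) ≤ 1# → x ≤ 1#
  d*x²≤1⇒x≤1 d {x} dx²≤1 with total x 1#
  ... | inj₁ x≤1 = x≤1
  ... | inj₂ 1≤x = begin
    x                  ≤⟨ x≤r*x 1≤x (1≤⇒0≤ 1≤x) ⟩
    x * x              ≤⟨ x≤r*x (1≤fromℕ d) (0≤x*x x) ⟩
    fromℕ d * (x * x)  ≤⟨ dx²≤1 ⟩
    1#                 ∎

  -- Put `σ = d τ²`. Since `(1 + η)² (4 - 8η) = 4 - 12η² - 8η³`, the left side is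
  -- `4 + σ + (2η + η²) σ - 12η² - 8η³`. For `σ ≤ 1` its excess over `4 + σ` is at most `2η`,
  -- against `8η` on the right.
  ownSquaredDistance-ratio : ∀ d {η τ} → 0# ≤ η → τ ≈ fromℕ 2 * η → fromℕ d * (τ * τ) ≤ 1# →
    (1# + η) * (1# + η) * ownSquaredDistance d τ (τ * τ) ≤ ownSquaredDistance d (- τ) (τ * τ)
  ownSquaredDistance-ratio d {η} {τ} 0≤η τ≈2η σ≤1 = ≤-by _
    (+-nonNeg (+-nonNeg (*-nonNeg (fromℕ-nonNeg 6) 0≤η)
                        (*-nonNeg (+-nonNeg (*-nonNeg (fromℕ-nonNeg 2) 0≤η) (0≤x*x η)) (≤⇒0≤- σ≤1)))
              (+-nonNeg (*-nonNeg (fromℕ-nonNeg 11) (0≤x*x η))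
                        (*-nonNeg (*-nonNeg (fromℕ-nonNeg 8) 0≤η) (0≤x*x η))))
    (trans (+-congʳ (*-congˡ (+-congʳ (+-congˡ (-‿cong (*-congˡ τ≈2η))))))
      (trans (solve 2 (λ η σ →
          (:# 1 :+ η) :* (:# 1 :+ η) :* (:# 4 :- :# 4 :* (:# 2 :* η) :+ σ)
          :+ (:# 6 :* η :+ (:# 2 :* η :+ η :* η) :* (:# 1 :- σ) :+ (:# 11 :* (η :* η) :+ :# 8 :* η :* (η :* η)))
          := :# 4 :- :# 4 :* (:- (:# 2 :* η)) :+ σ) refl η (fromℕ d * (τ * τ)))
        (+-congʳ (+-congˡ (-‿cong (*-congˡ (-‿cong (sym τ≈2η))))))))

  -- If `10 * M ≤ N`, the left side of the last hypothesis is at least `(1 - ε) (1 + 4.5ε) N`, which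
  -- exceeds `(1 + ε) N` when `0 < ε ≤ 1/10`.
  size-bound : ∀ {ε N M} → 0# < ε → fromℕ 10 * ε ≤ 1# → 1# ≤ N →
    (1# - ε) * (N + fromℕ 5 * ε * (N - M)) ≤ (1# + ε) * N → N ≤ fromℕ 10 * M
  size-bound {ε} {N} {M} (0≤ε , 0≉ε) 10ε≤1 1≤N h with total N (fromℕ 10 * M)
  ... | inj₁ N≤10M = N≤10M
  ... | inj₂ 10M≤N = contradiction (antisym 0≤ε ε≤0) 0≉ε
    where
    0≤1-ε : 0# ≤ 1# - ε
    0≤1-ε = ≤⇒0≤- (≤-trans (x≤r*x (1≤fromℕ 10) 0≤ε) 10ε≤1)
    0≤N = 1≤⇒0≤ 1≤N
    ε≤0 : ε ≤ 0#
    -- The weights 20 and `10ε (1 - ε)` cancel `M`, the bound `10ε ≤ 1` absorbs the term in `ε²`,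
    -- and `1 ≤ N` replaces `εN` by `ε`.
    ε≤0 = ≤-by _
      (+-nonNeg
        (+-nonNeg (*-nonNeg (fromℕ-nonNeg 20) (≤⇒0≤- h))
          (*-nonNeg (*-nonNeg (*-nonNeg (fromℕ-nonNeg 10) 0≤ε) 0≤1-ε) (≤⇒0≤- 10M≤N)))
        (+-nonNeg (*-nonNeg (*-nonNeg (fromℕ-nonNeg 9) (≤⇒0≤- 10ε≤1)) (*-nonNeg 0≤ε 0≤N))
          (+-nonNeg (*-nonNeg (fromℕ-nonNeg 40) (*-nonNeg 0≤ε 0≤N)) (*-nonNeg 0≤ε (≤⇒0≤- 1≤N)))))
      (solve 3 (λ ε N M → ε :+
          (:# 20 :* ((:# 1 :+ ε) :* N :- (:# 1 :- ε) :* (N :+ :# 5 :* ε :* (N :- M)))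
            :+ :# 10 :* ε :* (:# 1 :- ε) :* (N :- :# 10 :* M)
            :+ (:# 9 :* (:# 1 :- :# 10 :* ε) :* (ε :* N) :+ (:# 40 :* (ε :* N) :+ ε :* (N :- :# 1))))
          := :# 0) refl ε N M)

  -- Comparing the costs of two systems of centers.

  module _ {k d : ℕ} .{{_ : NonZero k}} .{{_ : NonZero d}} {z ε : ℝ} (1≤z : 1# ≤ z) (0<ε : 0# < ε)
           (dτ²≤1 : fromℕ d * ((fromℕ 10 * ε) * (fromℕ 10 * ε)) ≤ 1#)
           {S : Subset (k ℕ.* d)} {w : Fin (k ℕ.* d) → ℝ}
           (coreset : IsCoreset k z ε (dataset k d) S w) where

    open IsCoreset coreset

    private
      P  = dataset k d
      n  = fromℕ (k ℕ.* d)
      τ  = fromℕ 10 * ε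
      η  = fromℕ 5 * ε

    0≤ε : 0# ≤ ε
    0≤ε = proj₁ 0<ε

    τ≤1 : τ ≤ 1#
    τ≤1 = d*x²≤1⇒x≤1 d dτ²≤1

    0≤1-ε : 0# ≤ 1# - ε
    0≤1-ε = ≤⇒0≤- (≤-trans (x≤r*x (1≤fromℕ 10) 0≤ε) τ≤1)

    0≤1+ε : 0# ≤ 1# + ε
    0≤1+ε = +-nonNeg 0≤1 0≤ε

    1≤1+η : 1# ≤ 1# + η
    1≤1+η = ≤-by η (*-nonNeg (fromℕ-nonNeg 5) 0≤ε) refl

    weight : ℝ
    weight = sum λ a → if lookup S a then w a else 0#

    0≤w : ∀ {a} → lookup S a ≡ true → 0# ≤ w a
    0≤w {a} a∈S = weight-nonNeg (lookup⇒[]= a S a∈S)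

    -1≤-τ : - 1# ≤ - τ
    -1≤-τ = ≤-by _ (≤⇒0≤- τ≤1) (solve 1 (λ τ → :- :# 1 :+ (:# 1 :- τ) := :- τ) refl τ)

    0≤τ : 0# ≤ τ
    0≤τ = *-nonNeg (fromℕ-nonNeg 10) 0≤ε

    -1≤0 : - 1# ≤ 0#
    -1≤0 = ≤-by 1# 0≤1 (-‿inverseˡ 1#)

    -τ≤0 : - τ ≤ 0#
    -τ≤0 = ≤-by τ 0≤τ (-‿inverseˡ τ)

    signed : Bool → ℝ
    signed b = if b then τ else - τ

    signed² : ∀ b → signed b * signed b ≈ τ * τ
    signed² true  = refl
    signed² false = solve 1 (λ τ → :- τ :* :- τ := τ :* τ) refl τ

    -1≤signed : ∀ b → - 1# ≤ signed b
    -1≤signed true  = ≤-trans -1≤0 0≤τ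
    -1≤signed false = -1≤-τ

    signed≤1 : ∀ b → signed b ≤ 1#
    signed≤1 true  = τ≤1
    signed≤1 false = ≤-trans -τ≤0 0≤1

    origins adapted : Fin k → Vector ℝ d
    origins j i = 0#
    adapted j i = signed (lookup S (combine j i))

    powerCost : ℝ → ℝ → ℝ
    powerCost x κ = (√ ownSquaredDistance d x κ) ^ʳ z

    pointCost-origins≤ : ∀ a → pointCost z P (centers origins) a ≤ powerCost 0# 0#
    pointCost-origins≤ a = pointCost≤ (λ _ _ → zeroˡ 0#) (λ _ _ → -1≤0) (λ _ _ → 0≤1) 1≤z a

    ≤pointCost-origins : ∀ a → powerCost 0# 0# ≤ pointCost z P (centers origins) a
    ≤pointCost-origins a = ≤pointCost (λ _ _ → zeroˡ 0#) (λ _ _ → -1≤0) (λ _ _ → 0≤1) 1≤z a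

    adapted-remQuot : ∀ a → adapted (proj₁ (remQuot {k} d a)) (proj₂ (remQuot {k} d a)) ≡ signed (lookup S a)
    adapted-remQuot a = ≡.cong (signed ∘ lookup S) (combine-remQuot {k} d a)

    pointCost-adapted≤ : ∀ a → pointCost z P (centers adapted) a ≤ powerCost (signed (lookup S a)) (τ * τ)
    pointCost-adapted≤ a = ≡.subst (λ x → pointCost z P (centers adapted) a ≤ powerCost x (τ * τ)) (adapted-remQuot a)
      (pointCost≤ {o = adapted} (λ j i → signed² (lookup S (combine j i)))
        (λ j i → -1≤signed (lookup S (combine j i))) (λ j i → signed≤1 (lookup S (combine j i))) 1≤z a)

    ≤pointCost-adapted : ∀ a → powerCost (signed (lookup S a)) (τ * τ) ≤ pointCost z P (centers adapted) a
    ≤pointCost-adapted a = ≡.subst (λ x → powerCost x (τ * τ) ≤ pointCost z P (centers adapted) a) (adapted-remQuot a)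
      (≤pointCost {o = adapted} (λ j i → signed² (lookup S (combine j i)))
        (λ j i → -1≤signed (lookup S (combine j i))) (λ j i → signed≤1 (lookup S (combine j i))) 1≤z a)

    1≤powerCost-0 : 1# ≤ powerCost 0# 0#
    1≤powerCost-0 = 1≤^ʳ 1≤z (1≤√ (≤-by _ (fromℕ-nonNeg 3)
      (solve 1 (λ d → :# 1 :+ :# 3 := :# 4 :- :# 4 :* :# 0 :+ d :* :# 0) refl (fromℕ d))))

    1≤own-τ : 1# ≤ ownSquaredDistance d τ (τ * τ)
    -- `1≤own` speaks of families of offsets, so a constant family stands in; `k` and `d` are
    -- nonzero, which provides indices.
    1≤own-τ = 1≤own {k} {d} {o = λ _ _ → τ} (λ _ _ → refl)
      (λ _ _ → -1≤signed true) (λ _ _ → τ≤1) (first k) (first d)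
      where
      first : ∀ m .{{_ : NonZero m}} → Fin m
      first (suc m) = zero

    1≤powerCost-τ : 1# ≤ powerCost τ (τ * τ)
    1≤powerCost-τ = 1≤^ʳ 1≤z (1≤√ 1≤own-τ)

    powerCost-ratio : (1# + η) * powerCost τ (τ * τ) ≤ powerCost (- τ) (τ * τ)
    powerCost-ratio = √^ʳ-*-≤ 1≤z 1≤1+η 1≤own-τ (ownSquaredDistance-ratio d
      (*-nonNeg (fromℕ-nonNeg 5) 0≤ε)
      (solve 1 (λ ε → :# 10 :* ε := :# 2 :* (:# 5 :* ε)) refl ε) dτ²≤1)

    -- All points cost the same `f` at the undisplaced centers, so the weighted cost there is
    -- `f * weight`, and `f` cancels from the upper coreset bound.
    weight≤ : weight ≤ (1# + ε) * n
    weight≤ = *-cancelˡ-≤ 1≤powerCost-0 (begin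
      f * weight                                         ≈⟨ *-distribˡ-sum f (λ a → if lookup S a then w a else 0#) ⟩
      sum (λ a → f * (if lookup S a then w a else 0#))   ≤⟨ sum-mono-≤ (λ a → below a (lookup S a) ≡.refl) ⟩
      weightedCost z P S w (centers origins)             ≤⟨ upper (centers origins) (centers-distinct origins) ⟩
      (1# + ε) * cost z P (centers origins)              ≤⟨ *-monoʳ-≤ 0≤1+ε (sum-mono-≤ pointCost-origins≤) ⟩
      (1# + ε) * sum {k ℕ.* d} (λ _ → f)                 ≈⟨ *-congˡ (sum-constant (k ℕ.* d)) ⟩
      (1# + ε) * (n * f)                                 ≈⟨ solve 3 (λ e n f → e :* (n :* f) := f :* (e :* n)) refl (1# + ε) n f ⟩
      f * ((1# + ε) * n)                                 ∎)
      where
      f = powerCost 0# 0#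
      -- Abstracting `lookup S a` as `b` lets the conditionals reduce, while the equation keeps the
      -- membership that makes `w a` nonnegative.
      below : ∀ a b → lookup S a ≡ b →
              f * (if b then w a else 0#) ≤ (if b then w a * pointCost z P (centers origins) a else 0#)
      below a true  a∈S = ≤-respˡ-≈ (*-comm (w a) f) (*-monoʳ-≤ (0≤w a∈S) (≤pointCost-origins a))
      below a false _   = ≤-reflexive (zeroʳ f)

    -- Only points of `S` are counted, and for them the sign in `adapted` is positive, which gives
    -- the cheaper cost.
    weighted-adapted≤ : weightedCost z P S w (centers adapted) ≤ powerCost τ (τ * τ) * weight
    weighted-adapted≤ = ≤-respʳ-≈ (sym (*-distribˡ-sum f (λ a → if lookup S a then w a else 0#)))
      (sum-mono-≤ (λ a → above a (lookup S a) ≡.refl (pointCost-adapted≤ a)))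
      where
      f = powerCost τ (τ * τ)
      above : ∀ a b → lookup S a ≡ b →
              pointCost z P (centers adapted) a ≤ powerCost (signed b) (τ * τ) →
              (if b then w a * pointCost z P (centers adapted) a else 0#) ≤ f * (if b then w a else 0#)
      above a true  a∈S p≤f = ≤-respʳ-≈ (*-comm (w a) f) (*-monoʳ-≤ (0≤w a∈S) p≤f)
      above a false _   _   = ≤-reflexive (sym (zeroʳ f))

    -- The `n - ∣ S ∣` points outside `S` have their center pushed away, and `powerCost-ratio`
    -- charges each the factor `1# + η`.
    ≤cost-adapted : powerCost τ (τ * τ) * (n + η * (n - fromℕ ∣ S ∣)) ≤ cost z P (centers adapted)
    ≤cost-adapted = begin
      f * (n + η * (n - m))                                 ≈⟨ *-congˡ count ⟨
      f * sum (λ a → if lookup S a then 1# else 1# + η)     ≈⟨ *-distribˡ-sum f (λ a → if lookup S a then 1# else 1# + η) ⟩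
      sum (λ a → f * (if lookup S a then 1# else 1# + η))   ≤⟨ sum-mono-≤ (λ a → below a (lookup S a) (≤pointCost-adapted a)) ⟩
      cost z P (centers adapted)                            ∎
      where
      f = powerCost τ (τ * τ)
      m = fromℕ ∣ S ∣
      count : sum (λ a → if lookup S a then 1# else 1# + η) ≈ n + η * (n - m)
      count = begin-equality
        s                                         ≈⟨ solve 3 (λ s m η → s := s :+ m :* (:# 1 :+ η) :- m :* (:# 1 :+ η)) refl s m η ⟩
        s + m * (1# + η) - m * (1# + η)           ≈⟨ +-congʳ (sum-if-∈ S 1# (1# + η)) ⟩
        m * 1# + n * (1# + η) - m * (1# + η)      ≈⟨ solve 3 (λ m n η → m :* :# 1 :+ n :* (:# 1 :+ η) :- m :* (:# 1 :+ η) := n :+ η :* (n :- m)) refl m n η ⟩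
        n + η * (n - m)                           ∎
        where
        s = sum (λ a → if lookup S a then 1# else 1# + η)
      below : ∀ a b → powerCost (signed b) (τ * τ) ≤ pointCost z P (centers adapted) a →
              f * (if b then 1# else 1# + η) ≤ pointCost z P (centers adapted) a
      below a true  f≤p = ≤-respˡ-≈ (sym (*-identityʳ f)) f≤p
      below a false f≤p = ≤-trans (≤-respˡ-≈ (*-comm _ _) powerCost-ratio) f≤p

    -- The lower coreset bound at `adapted` meets the bound on the weight obtained from `origins`.
    -- Cancelling the cost of a cheap point leaves the hypothesis of `size-bound` with `N = n` and
    -- `M = ∣ S ∣`.
    coreset-size : n ≤ fromℕ 10 * fromℕ ∣ S ∣
    coreset-size = size-bound 0<ε τ≤1 (1≤fromℕ (k ℕ.* d) {{ℕ.m*n≢0 k d}}) (*-cancelˡ-≤ 1≤powerCost-τ (begin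
      f * ((1# - ε) * (n + η * (n - m)))        ≈⟨ solve 3 (λ f e x → f :* (e :* x) := e :* (f :* x)) refl f (1# - ε) (n + η * (n - m)) ⟩
      (1# - ε) * (f * (n + η * (n - m)))        ≤⟨ *-monoʳ-≤ 0≤1-ε ≤cost-adapted ⟩
      (1# - ε) * cost z P (centers adapted)     ≤⟨ lower (centers adapted) (centers-distinct adapted) ⟩
      weightedCost z P S w (centers adapted)    ≤⟨ weighted-adapted≤ ⟩
      f * weight                                ≤⟨ *-monoʳ-≤ (1≤⇒0≤ 1≤powerCost-τ) weight≤ ⟩
      f * ((1# + ε) * n)                        ∎))
      where
      f = powerCost τ (τ * τ)
      m = fromℕ ∣ S ∣

  -- As `z ^ 4` is at least 1, `10 * M` is at most `10 * z ^ 4 * M`; dividing by `10 * z ^ 4` gives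
  -- the bound.
  quotient-bound : ∀ k d {z M} → 1# ≤ z → 0# ≤ M → fromℕ (k ℕ.* d) ≤ fromℕ 10 * M →
                   (fromℕ d * fromℕ k) / (fromℕ 10 * z ^ 4) ≤ M
  quotient-bound k d {z} {M} 1≤z 0≤M n≤10M = begin
    fromℕ d * fromℕ k * y ⁻¹         ≈⟨ *-congʳ (*-comm _ _) ⟩
    fromℕ k * fromℕ d * y ⁻¹         ≈⟨ *-congʳ (×1-homo-* k d) ⟨
    fromℕ (k ℕ.* d) * y ⁻¹           ≤⟨ *-monoˡ-≤ (⁻¹-nonNeg 1≤y) n≤10M ⟩
    fromℕ 10 * M * y ⁻¹              ≤⟨ *-monoˡ-≤ (⁻¹-nonNeg 1≤y) (*-monoʳ-≤ (fromℕ-nonNeg 10) (x≤r*x (1≤^ 1≤z 4) 0≤M)) ⟩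
    fromℕ 10 * (z ^ 4 * M) * y ⁻¹    ≈⟨ solve 4 (λ t v M i → t :* (v :* M) :* i := t :* v :* (i :* M)) refl (fromℕ 10) (z ^ 4) M (y ⁻¹) ⟩
    y * (y ⁻¹ * M)                   ≈⟨ r*r⁻¹*x≈x M 1≤y ⟩
    M                                ∎
    where
    y = fromℕ 10 * z ^ 4
    1≤y = 1≤* (1≤fromℕ 10) (1≤^ 1≤z 4)

theorem3p8 :
  (R : CompleteOrderedField) →
  let open CompleteOrderedField R renaming (Carrier to ℝ)
      open Clustering R
  in
  (k : ℕ) .{{_ : NonZero k}} (z ε : ℝ) →
  1# ≤ z → 0# < ε → ε < 1# →
  (d : ℕ) .{{_ : NonZero d}} →
  fromℕ d ≤ 1# / (fromℕ 100 * ε ^ 2) →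
  ∃₂ λ (n : ℕ) (P : Vector (Point (suc d)) n) →
    Distinct P ×
    ((S : Subset n) (w : Fin n → ℝ) → IsCoreset k z ε P S w →
      (fromℕ d * fromℕ k) / (fromℕ 10 * z ^ 4) ≤ fromℕ ∣ S ∣)
theorem3p8 R k z ε 1≤z 0<ε ε<1 d d≤ =
  k ℕ.* d , dataset k d , dataset-distinct k d , λ S w coreset →
    quotient-bound k d 1≤z (fromℕ-nonNeg ∣ S ∣) (coreset-size 1≤z 0<ε (tolerance-bound d 0<ε d≤) coreset)
  where
  open OrderedField R using (fromℕ-nonNeg)
  open Geometry R using (dataset; dataset-distinct)
  open LowerBound R using (quotient-bound; coreset-size; tolerance-bound)
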